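{- Let $A\subseteq\omega$ be an infinite c.e. set and let $\theta$ be a quasi-Gödel numbering of $\mathcal S^{(1)}_A$. Then: (1) $\theta$ is complete with the nowhere defined function as distinguished element; that is, for every $p\in\mathcal P^{(1)}$ there exists $g\in\mathcal R^{(1)}$ such that for all $i\in\omega$: $\theta_{g(i)}=\theta_{p(i)}$ if $i\in\mathrm{dom}(p)$, and $\theta_{g(i)}$ is the nowhere defined function otherwise. (2) $\theta$ is cylindrical; that is, $\theta$ is computably isomorphic to the numbering $\theta^c$ defined by $\theta^c_{\langle i,j\rangle}=\theta_j$ (there is a computable bijection $h:\omega\to\omega$ with $\theta^c=\theta\circ h$).
   Context: $\omega$ is the set of natural numbers; $\mathcal P^{(n)}$ and $\mathcal R^{(n)}$ are the sets of $n$-ary partial, respectively total, computable functions on $\omega$. $\langle\cdot,\cdot\rangle:\omega^2\to\omega$ is a computable bijection with $\langle x,y\rangle\ge x,y$. $\mathrm{Anf}^{(1)}_A$ is the set of partial functions from $\omega$ to $\omega$ whose domain is either empty or equal to $\{0,\dots,a-1\}$ for some $a\in A$, and $\mathcal S^{(1)}_A=\mathcal R^{(1)}\cup\mathrm{Anf}^{(1)}_A$. The extended graph of a unary partial function $q$ is $\{\langle y,0\rangle:y\in\omega\}\cup\{\langle x,q(x)+1\rangle:x\in\mathrm{dom}(q)\}$; that of a binary partial function $q$ is $\{\langle\langle y,y'\rangle,0\rangle:y,y'\in\omega\}\cup\{\langle\langle x,x'\rangle,q(x,x')+1\rangle:(x,x')\in\mathrm{dom}(q)\}$. A numbering of a set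 $X$ is a surjection $\omega\to X$. A numbering $\theta$ of $\mathcal S^{(1)}_A$ is a quasi-Gödel numbering if: (QGN I) the extended graph of $(i,x)\mapsto\theta_i(x)$ is the range of a function in $\mathcal R^{(1)}$; and (QGN II) for every $k\in\mathcal R^{(2)}$ there is $v\in\mathcal R^{(1)}$ such that for all $i\in\omega$, $r\in\mathcal S^{(1)}_A$: if $\{k(i,t):t\in\omega\}$ is the extended graph of $r$, then $r=\theta_{v(i)}$. -}

module Defs where

open import Data.Empty using (⊥)
open import Data.Fin.Base using (Fin)
open import Data.Nat.Base using (ℕ; zero; suc; _<_; _≤_)
open import Data.Product.Base using (∃; ∃₂; _×_; _,_; proj₂; uncurry)
open import Data.Sum.Base using (_⊎_)
open import Data.Vec.Base using (Vec; []; _∷_; lookup)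
open import Data.Vec.Relation.Binary.Pointwise.Inductive using (Pointwise)
open import Function.Base using (_∘_)
open import Function.Bundles using (_⇔_; _↔_; Inverse)
open import Level using (0ℓ)
open import Relation.Binary.PropositionalEquality.Core using (_≡_; refl; sym; trans)
open import Relation.Unary using (Pred; _∈_; _∉_; _≐_)

infixr 1 _⇀_
infix 4 _≈_ _[_]⇓_

-- Partial functions are single-valued graphs; no decidability of the domain
-- and no computability is built in.
record _⇀_ (X Y : Set) : Set₁ where
  field
    graph      : X → Y → Set
    functional : ∀ {x y z} → graph x y → graph x z → y ≡ z

open _⇀_ public

dom : ∀ {X Y} → X ⇀ Y → Pred X 0ℓ
dom f x = ∃ λ y → graph f x y

_≈_ : ∀ {X Y} → X ⇀ Y → X ⇀ Y → Set
f ≈ g = ∀ x y → graph f x y ⇔ graph g x y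

nowhere : ∀ {X Y} → X ⇀ Y
nowhere .graph _ _ = ⊥
nowhere .functional ()

total : ∀ {X Y} → (X → Y) → X ⇀ Y
total f .graph x y = f x ≡ y
total f .functional p q = trans (sym p) q

range : ∀ {X Y : Set} → (X → Y) → Pred Y 0ℓ
range f y = ∃ λ x → f x ≡ y

-- Programs for the partial recursive functions (Kleene's schemes).
data Rec : ℕ → Set where
  zer  : ∀ {n} → Rec n
  succ : Rec 1
  proj : ∀ {n} → Fin n → Rec n
  comp : ∀ {m n} → Rec m → Vec (Rec n) m → Rec n
  prec : ∀ {n} → Rec n → Rec (suc (suc n)) → Rec (suc n)
  min  : ∀ {n} → Rec (suc n) → Rec n

-- c [ xs ]⇓ y : the program c halts on input xs with output y.
data _[_]⇓_ : ∀ {n} → Rec n → Vec ℕ n → ℕ → Set where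
  zer⇓  : ∀ {n} {xs : Vec ℕ n} → zer [ xs ]⇓ 0
  succ⇓ : ∀ {x} → succ [ x ∷ [] ]⇓ suc x
  proj⇓ : ∀ {n} {i : Fin n} {xs} → proj i [ xs ]⇓ lookup xs i
  comp⇓ : ∀ {m n} {f : Rec m} {gs : Vec (Rec n) m} {xs ys z} →
          Pointwise (λ g y → g [ xs ]⇓ y) gs ys → f [ ys ]⇓ z →
          comp f gs [ xs ]⇓ z
  prec⇓-zero : ∀ {n} {f : Rec n} {g xs y} →
          f [ xs ]⇓ y → prec f g [ zero ∷ xs ]⇓ y
  prec⇓-suc  : ∀ {n} {f : Rec n} {g k xs y z} →
          prec f g [ k ∷ xs ]⇓ y → g [ k ∷ y ∷ xs ]⇓ z →
          prec f g [ suc k ∷ xs ]⇓ z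
  -- All values below the least zero must be defined (and nonzero).
  min⇓  : ∀ {n} {f : Rec (suc n)} {xs y} →
          (∀ {k} → k < y → ∃ λ w → f [ k ∷ xs ]⇓ suc w) →
          f [ y ∷ xs ]⇓ 0 → min f [ xs ]⇓ y

-- 𝒫⁽ⁿ⁾ and ℛ⁽ⁿ⁾ for n = 1, 2; binary functions take pairs as arguments.
𝒫¹ : Pred (ℕ ⇀ ℕ) 0ℓ
𝒫¹ p = ∃ λ (c : Rec 1) → ∀ x y → graph p x y ⇔ c [ x ∷ [] ]⇓ y

𝒫² : Pred (ℕ × ℕ ⇀ ℕ) 0ℓ
𝒫² p = ∃ λ (c : Rec 2) → ∀ x x′ y → graph p (x , x′) y ⇔ c [ x ∷ x′ ∷ [] ]⇓ y

ℛ¹ : Pred (ℕ → ℕ) 0ℓ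
ℛ¹ f = 𝒫¹ (total f)

ℛ² : Pred (ℕ → ℕ → ℕ) 0ℓ
ℛ² f = 𝒫² (total (uncurry f))

ComputablyEnumerable : Pred (Pred ℕ 0ℓ) _
ComputablyEnumerable A = ∃ λ p → 𝒫¹ p × A ≐ dom p

record Pairing : Set where
  field
    bijection : (ℕ × ℕ) ↔ ℕ

  ⟨_,_⟩ : ℕ → ℕ → ℕ
  ⟨ x , y ⟩ = Inverse.to bijection (x , y)

  π₂ : ℕ → ℕ
  π₂ = proj₂ ∘ Inverse.from bijection

  field
    computable : ℛ² ⟨_,_⟩
    left≤      : ∀ x y → x ≤ ⟨ x , y ⟩
    right≤     : ∀ x y → y ≤ ⟨ x , y ⟩

Anf : Pred ℕ 0ℓ → Pred (ℕ ⇀ ℕ) 0ℓ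
Anf A q = (∀ x → x ∉ dom q) ⊎ (∃ λ a → a ∈ A × (∀ x → x ∈ dom q ⇔ x < a))

𝒮 : Pred ℕ 0ℓ → Pred (ℕ ⇀ ℕ) 0ℓ
𝒮 A q = (∃ λ f → ℛ¹ f × q ≈ total f) ⊎ Anf A q

-- Surjectivity is up to _≈_, the extensional equality of partial functions.
record IsNumbering (X : Pred (ℕ ⇀ ℕ) 0ℓ) (θ : ℕ → (ℕ ⇀ ℕ)) : Set₁ where
  field
    into : ∀ i → θ i ∈ X
    onto : ∀ r → r ∈ X → ∃ λ i → θ i ≈ r

-- The binary partial function (i , x) ↦ θᵢ(x).
universal : (ℕ → (ℕ ⇀ ℕ)) → (ℕ × ℕ ⇀ ℕ)
universal θ .graph (i , x) = graph (θ i) x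
universal θ .functional {i , _} = functional (θ i)

IsComplete : (ℕ → (ℕ ⇀ ℕ)) → (ℕ ⇀ ℕ) → Set₁
IsComplete θ e =
  ∀ p → 𝒫¹ p → ∃ λ g → ℛ¹ g ×
    (∀ i → (∀ j → graph p i j → θ (g i) ≈ θ j) × (i ∉ dom p → θ (g i) ≈ e))

ComputablyIsomorphic : (θ η : ℕ → (ℕ ⇀ ℕ)) → Set
ComputablyIsomorphic θ η =
  ∃ λ (h : ℕ ↔ ℕ) → ℛ¹ (Inverse.to h) × (∀ n → η n ≈ θ (Inverse.to h n))

module _ (pairing : Pairing) where
  open Pairing pairing

  ExtGraph¹ : (ℕ ⇀ ℕ) → Pred ℕ 0ℓ
  ExtGraph¹ q z =
    (∃ λ y → z ≡ ⟨ y , 0 ⟩) ⊎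
    (∃₂ λ x y → graph q x y × z ≡ ⟨ x , suc y ⟩)

  ExtGraph² : (ℕ × ℕ ⇀ ℕ) → Pred ℕ 0ℓ
  ExtGraph² q z =
    (∃₂ λ y y′ → z ≡ ⟨ ⟨ y , y′ ⟩ , 0 ⟩) ⊎
    (∃₂ λ x x′ → ∃ λ y → graph q (x , x′) y × z ≡ ⟨ ⟨ x , x′ ⟩ , suc y ⟩)

  record IsQuasiGödel (A : Pred ℕ 0ℓ) (θ : ℕ → (ℕ ⇀ ℕ)) : Set₁ where
    field
      isNumbering : IsNumbering (𝒮 A) θ
      qgn₁ : ∃ λ f → ℛ¹ f × ExtGraph² (universal θ) ≐ range f
      qgn₂ : ∀ k → ℛ² k → ∃ λ v → ℛ¹ v ×
             (∀ i r → r ∈ 𝒮 A → range (k i) ≐ ExtGraph¹ r → r ≈ θ (v i))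

  -- θᶜ⟨i,j⟩ = θⱼ
  cylinder : (ℕ → (ℕ ⇀ ℕ)) → (ℕ → (ℕ ⇀ ℕ))
  cylinder θ n = θ (π₂ n)

  IsCylindrical : (ℕ → (ℕ ⇀ ℕ)) → Set
  IsCylindrical θ = ComputablyIsomorphic θ (cylinder θ)

{-# OPTIONS --safe #-}

-- θ enumerates its own universal function and contains all total computable
-- functions, so it can take the place of a universal machine.  Enumerating the
-- graph of θ_{p(i)} once p(i) has been computed, and nothing before, gives (1) by
-- (QGN II).  For (2), (1) applied to the diagonal z ↦ θ_{π₂ z}(z) yields the
-- recursion theorem for θ.  Its fixed points, used to spoil every index ≤ N, give
-- arbitrarily large indices of θᵢ, computably in i, hence a strictly increasing f
-- with θ_{f(n)} = θᶜₙ.  Together with m ↦ ⟨0,m⟩ in the other direction, the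
-- Cantor–Bernstein construction produces a computable bijection.

module Submission where

open import Defs
open import Data.Fin.Base using (Fin; zero; suc; fromℕ<; toℕ)
open import Data.Fin.Patterns using (0F; 1F; 2F; 3F)
open import Data.Fin.Properties using (pigeonhole; toℕ<n; fromℕ<-injective)
open import Data.Nat.Base
  using (ℕ; zero; suc; pred; _+_; _∸_; ∣_-_∣; _⊔_; _<_; _≤_; z≤n; s≤s; s≤s⁻¹)
open import Data.Nat.InfinitelyOften using (Inf)
open import Data.Nat.Properties
open import Data.Product.Base using (∃; ∃₂; _×_; _,_; proj₁; proj₂)
open import Data.Sum.Base using (_⊎_; inj₁; inj₂)
open import Data.Vec.Base using (Vec; []; _∷_; lookup; head; tail; tabulate; map)
open import Data.Vec.Properties using (lookup-map; ∷-injectiveˡ; ∷-injectiveʳ; map-∘; map-id)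
open import Data.Vec.Relation.Binary.Pointwise.Inductive using (Pointwise; []; _∷_)
open import Function.Base using (_∘_; id; case_of_; const)
open import Function.Bundles using (_⇔_; _↔_; Equivalence; Inverse; mk⇔; mk↔ₛ′)
import Function.Properties.Equivalence as ⇔
open import Level using (0ℓ)
open import Relation.Binary.Definitions using (tri<; tri≈; tri>)
open import Relation.Binary.PropositionalEquality
open import Relation.Nullary using (¬_; yes; no; contradiction)
open import Relation.Unary using (Pred; _∈_; _≐_)

private variable
  l m n : ℕ

-- Primitive recursion and bounded search on numbers

recℕ : ∀ {a} {A : Set a} → A → (ℕ → A → A) → ℕ → A
recℕ z s zero    = z
recℕ z s (suc k) = s k (recℕ z s k)

-- Branching is an instance of `recℕ`, as are `bind` and `search`, so that its computability reduces
-- to the scheme of primitive recursion.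
ifZero : ℕ → ℕ → ℕ → ℕ
ifZero c a b = recℕ a (λ _ _ → b) c

-- Values of partial computations are encoded as numbers: 0 for "undefined",
-- suc w for the value w.
bind : ℕ → (ℕ → ℕ) → ℕ
bind a f = recℕ 0 (λ w _ → f w) a

bind-suc⁻¹ : ∀ a {f y} → bind a f ≡ suc y → ∃ λ w → a ≡ suc w × f w ≡ suc y
bind-suc⁻¹ (suc w) eq = w , refl , eq

-- The result 1 encodes a dummy value, so that `bind` can use the whole expression as a guard.
allDefined : Vec ℕ n → ℕ
allDefined []       = 1
allDefined (o ∷ os) = bind o λ _ → allDefined os

allDefined-suc⁻¹ : (os : Vec ℕ n) → ∀ {w} → allDefined os ≡ suc w → os ≡ map suc (map pred os)
allDefined-suc⁻¹ []           _  = refl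
allDefined-suc⁻¹ (suc o ∷ os) eq = cong (suc o ∷_) (allDefined-suc⁻¹ os eq)

allDefined-map-suc : (ys : Vec ℕ n) → allDefined (map suc ys) ≡ 1
allDefined-map-suc []       = refl
allDefined-map-suc (y ∷ ys) = allDefined-map-suc ys

map-pred-suc : (ys : Vec ℕ n) → map pred (map suc ys) ≡ ys
map-pred-suc ys = trans (sym (map-∘ pred suc ys)) (map-id ys)

-- The least zero of f below b, or b if there is none.
search : (ℕ → ℕ) → ℕ → ℕ
search f = recℕ 0 λ _ r → ifZero (f r) r (suc r)

search≤ : ∀ f b → search f b ≤ b
search≤ f zero    = z≤n
search≤ f (suc b) with f (search f b)
... | zero  = m≤n⇒m≤1+n (search≤ f b)
... | suc _ = s≤s (search≤ f b)

search-below : ∀ f b {j} → j < search f b → f j ≢ 0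
search-below f (suc b) {j} j<r eq with f (search f b) in fr
... | zero  = search-below f b j<r eq
... | suc w with m<1+n⇒m<n∨m≡n j<r
...   | inj₁ j<r′ = search-below f b j<r′ eq
...   | inj₂ refl = case trans (sym fr) eq of λ ()

search-zero : ∀ f b → search f b < b → f (search f b) ≡ 0
search-zero f (suc b) r<b with f (search f b) in fr
... | zero  = fr
... | suc w = contradiction (trans (sym fr) (search-zero f b (s≤s⁻¹ r<b))) λ ()

-- By trichotomy: a result below `k` would be a zero excluded by assumption, and a result above `k`
-- would have missed the zero at `k`. For `k ≡ b` the default value is meant, and no zero is
-- required.
search-unique : ∀ f b {k} → k ≤ b → (∀ {j} → j < k → f j ≢ 0) → (k < b → f k ≡ 0) →
                search f b ≡ k
search-unique f b {k} k≤b below zero-at with <-cmp (search f b) k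
... | tri< r<k _ _ = contradiction (search-zero f b (<-≤-trans r<k k≤b)) (below r<k)
... | tri≈ _ eq _  = eq
... | tri> _ _ k<r = contradiction (zero-at (<-≤-trans k<r (search≤ f b))) (search-below f b k<r)

search-only : ∀ f b {k} → k < b → f k ≡ 0 → (∀ {j} → f j ≡ 0 → j ≡ k) → search f b ≡ k
search-only f b k<b fk≡0 only =
  search-unique f b (<⇒≤ k<b) (λ j<k fj≡0 → <⇒≢ j<k (only fj≡0)) (λ _ → fk≡0)

-- Total computable functions

-- That no other output is possible comes from `⇓-deterministic`, which leads from here back to `ℛ¹`
-- and `ℛ²`.
Computable : (Vec ℕ n → ℕ) → Set
Computable {n} f = ∃ λ (c : Rec n) → ∀ xs → c [ xs ]⇓ f xs

Computable₁ : (ℕ → ℕ) → Set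
Computable₁ f = ∃ λ (c : Rec 1) → ∀ x → c [ x ∷ [] ]⇓ f x

Computable₂ : (ℕ → ℕ → ℕ) → Set
Computable₂ f = ∃ λ (c : Rec 2) → ∀ x y → c [ x ∷ y ∷ [] ]⇓ f x y

Computables : (Vec ℕ n → Vec ℕ m) → Set
Computables {n} {m} g =
  ∃ λ (cs : Vec (Rec n) m) → ∀ xs → Pointwise (λ c y → c [ xs ]⇓ y) cs (g xs)

Computable-resp-≗ : {f g : Vec ℕ n → ℕ} → f ≗ g → Computable f → Computable g
Computable-resp-≗ f≗g (c , c⇓) = c , λ xs → subst (c [ xs ]⇓_) (f≗g xs) (c⇓ xs)

fn₁ : {f : Vec ℕ 1 → ℕ} → Computable f → Computable₁ (λ x → f (x ∷ []))
fn₁ (c , c⇓) = c , λ x → c⇓ (x ∷ [])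

fn₂ : {f : Vec ℕ 2 → ℕ} → Computable f → Computable₂ (λ x y → f (x ∷ y ∷ []))
fn₂ (c , c⇓) = c , λ x y → c⇓ (x ∷ y ∷ [])

infixr 5 _◂_

∅ : Computables {n} (λ _ → [])
∅ = [] , λ _ → []

_◂_ : {f : Vec ℕ n → ℕ} {g : Vec ℕ n → Vec ℕ m} →
      Computable f → Computables g → Computables (λ xs → f xs ∷ g xs)
(c , c⇓) ◂ (cs , cs⇓) = (c ∷ cs) , λ xs → c⇓ xs ∷ cs⇓ xs

var : (i : Fin n) → Computable (λ xs → lookup xs i)
var i = proj i , λ _ → proj⇓

tuple : {g : Vec ℕ n → Vec ℕ m} → (∀ i → Computable (λ xs → lookup (g xs) i)) → Computables g
tuple {n} {g = g} h =
  tabulate (proj₁ ∘ h) , λ xs → pointwise xs (g xs) (proj₁ ∘ h) λ i → proj₂ (h i) xs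
  where
  pointwise : ∀ {m} (xs : Vec ℕ n) (ys : Vec ℕ m) (cs : Fin m → Rec n) →
              (∀ i → cs i [ xs ]⇓ lookup ys i) →
              Pointwise (λ c y → c [ xs ]⇓ y) (tabulate cs) ys
  pointwise xs []       cs cs⇓ = []
  pointwise xs (y ∷ ys) cs cs⇓ = cs⇓ zero ∷ pointwise xs ys (cs ∘ suc) (cs⇓ ∘ suc)

vars : (ρ : Fin m → Fin n) {g : Vec ℕ n → Vec ℕ m} →
       (∀ xs i → lookup xs (ρ i) ≡ lookup (g xs) i) → Computables g
vars ρ eq = tuple λ i → Computable-resp-≗ (λ xs → eq xs i) (var (ρ i))

all : Computables {n} id
all = vars id λ _ _ → refl

rest₁ : Computables {suc n} tail
rest₁ = vars suc λ { (_ ∷ _) _ → refl }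

rest₂ : Computables {suc (suc n)} (tail ∘ tail)
rest₂ = vars (λ i → suc (suc i)) λ { (_ ∷ _ ∷ _) _ → refl }

call : {f : Vec ℕ m → ℕ} {g : Vec ℕ n → Vec ℕ m} →
       Computable f → Computables g → Computable (f ∘ g)
call (c , c⇓) (cs , cs⇓) = comp c cs , λ xs → comp⇓ (cs⇓ xs) (c⇓ _)

after : {f : Vec ℕ m → Vec ℕ l} {g : Vec ℕ n → Vec ℕ m} →
        Computables g → Computables f → Computables (f ∘ g)
after {m} {l} {n} {g = g} (ds , ds⇓) (cs , cs⇓) =
  map (λ c → comp c ds) cs , λ xs → pointwise (cs⇓ (g xs)) (ds⇓ xs)
  where
  pointwise : ∀ {l} {cs : Vec (Rec m) l} {xs ys} {zs : Vec ℕ l} →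
              Pointwise (λ c y → c [ ys ]⇓ y) cs zs → Pointwise (λ c y → c [ xs ]⇓ y) ds ys →
              Pointwise (λ c y → c [ xs ]⇓ y) (map (λ c → comp c ds) cs) zs
  pointwise []       es = []
  pointwise (d ∷ ds) es = comp⇓ es d ∷ pointwise ds es

app₁ : {h : ℕ → ℕ} {f : Vec ℕ n → ℕ} →
       Computable₁ h → Computable f → Computable (h ∘ f)
app₁ (c , c⇓) (d , d⇓) = comp c (d ∷ []) , λ xs → comp⇓ (d⇓ xs ∷ []) (c⇓ _)

app₂ : {h : ℕ → ℕ → ℕ} {f g : Vec ℕ n → ℕ} →
       Computable₂ h → Computable f → Computable g → Computable (λ xs → h (f xs) (g xs))
app₂ (c , c⇓) (d , d⇓) (e , e⇓) =
  comp c (d ∷ e ∷ []) , λ xs → comp⇓ (d⇓ xs ∷ e⇓ xs ∷ []) (c⇓ _ _)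

`zero : Computable {n} (λ _ → 0)
`zero = zer , λ _ → zer⇓

`suc : {f : Vec ℕ n → ℕ} → Computable f → Computable (suc ∘ f)
`suc = app₁ (succ , λ _ → succ⇓)

`const : ∀ k → Computable {n} (λ _ → k)
`const zero    = `zero
`const (suc k) = `suc (`const k)

`rec : {t b : Vec ℕ n → ℕ} {s : Vec ℕ (suc (suc n)) → ℕ} →
       Computable t → Computable b → Computable s →
       Computable (λ xs → recℕ (b xs) (λ k r → s (k ∷ r ∷ xs)) (t xs))
`rec {b = b} {s} t (cb , b⇓) (cs , s⇓) = call {f = f} (prec cb cs , f⇓) (t ◂ all)
  where
  f : Vec ℕ (suc _) → ℕ
  f (k ∷ xs) = recℕ (b xs) (λ k r → s (k ∷ r ∷ xs)) k
  f⇓ : ∀ xs → prec cb cs [ xs ]⇓ f xs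
  f⇓ (zero  ∷ xs) = prec⇓-zero (b⇓ xs)
  f⇓ (suc k ∷ xs) = prec⇓-suc (f⇓ (k ∷ xs)) (s⇓ _)

`ifZero : {c a b : Vec ℕ n → ℕ} → Computable c → Computable a → Computable b →
          Computable (λ xs → ifZero (c xs) (a xs) (b xs))
`ifZero c a b = `rec c a (call b rest₂)

`bind : {a : Vec ℕ n → ℕ} {f : Vec ℕ (suc n) → ℕ} → Computable a → Computable f →
        Computable (λ xs → bind (a xs) (λ w → f (w ∷ xs)))
`bind a f = `rec a `zero (call f (var 0F ◂ rest₂))

`search : {f : Vec ℕ (suc n) → ℕ} {b : Vec ℕ n → ℕ} → Computable f → Computable b →
          Computable (λ xs → search (λ k → f (k ∷ xs)) (b xs))
`search f b =
  `rec b `zero (`ifZero (call f (var 1F ◂ rest₂)) (var 1F) (`suc (var 1F)))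

`pred : {f : Vec ℕ n → ℕ} → Computable f → Computable (pred ∘ f)
`pred {f = f} f′ = Computable-resp-≗ (λ xs → lemma (f xs)) (`bind f′ (var 0F))
  where
  lemma : ∀ k → bind k id ≡ pred k
  lemma zero    = refl
  lemma (suc k) = refl

_`∸_ : {f g : Vec ℕ n → ℕ} → Computable f → Computable g → Computable (λ xs → f xs ∸ g xs)
_`∸_ {f = f} {g} f′ g′ =
  Computable-resp-≗ (λ xs → lemma (f xs) (g xs)) (`rec g′ f′ (`pred (var 1F)))
  where
  lemma : ∀ a k → recℕ a (λ _ → pred) k ≡ a ∸ k
  lemma a zero    = refl
  lemma a (suc k) = trans (cong pred (lemma a k)) (pred[m∸n]≡m∸[1+n] a k)

_`+_ : {f g : Vec ℕ n → ℕ} → Computable f → Computable g → Computable (λ xs → f xs + g xs)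
_`+_ {f = f} {g} f′ g′ =
  Computable-resp-≗ (λ xs → lemma (f xs) (g xs)) (`rec f′ g′ (`suc (var 1F)))
  where
  lemma : ∀ k b → recℕ b (λ _ → suc) k ≡ k + b
  lemma zero    b = refl
  lemma (suc k) b = cong suc (lemma k b)

-- Distance serves as the equality test throughout: it is 0 exactly when both sides agree.
`∣_-_∣ : {f g : Vec ℕ n → ℕ} → Computable f → Computable g → Computable (λ xs → ∣ f xs - g xs ∣)
`∣_-_∣ {f = f} {g} f′ g′ =
  Computable-resp-≗ (λ xs → lemma (f xs) (g xs)) ((f′ `∸ g′) `+ (g′ `∸ f′))
  where
  lemma : ∀ a b → (a ∸ b) + (b ∸ a) ≡ ∣ a - b ∣
  lemma zero    zero    = refl
  lemma zero    (suc b) = refl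
  lemma (suc a) zero    = +-identityʳ (suc a)
  lemma (suc a) (suc b) = lemma a b

`allDefined : ∀ n → Computable (allDefined {n})
`allDefined zero    = Computable-resp-≗ (λ { [] → refl }) (`suc `zero)
`allDefined (suc n) =
  Computable-resp-≗ (λ { (_ ∷ _) → refl }) (`bind (var 0F) (call (`allDefined n) rest₂))


mapPred : ∀ n → Computables (map {n = n} pred)
mapPred n = tuple λ i → Computable-resp-≗ (λ xs → sym (lookup-map i pred xs)) (`pred (var i))

-- Stage-bounded evaluation

-- A total computable approximation to each single program, so that programs need not be coded as
-- numbers. Monotonicity allows subcomputations to be merged at the maximum of their stages.
record Staged (c : Rec n) : Set where
  field
    eval       : ℕ → Vec ℕ n → ℕ
    computable : Computable (λ v → eval (lookup v 0F) (tail v))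
    mono       : ∀ {s t} xs {y} → s ≤ t → eval s xs ≡ suc y → eval t xs ≡ suc y
    sound      : ∀ {s} xs {y} → eval s xs ≡ suc y → c [ xs ]⇓ y
    complete   : ∀ {xs y} → c [ xs ]⇓ y → ∃ λ s → eval s xs ≡ suc y

record StagedVec (cs : Vec (Rec n) m) : Set where
  field
    evals      : ℕ → Vec ℕ n → Vec ℕ m
    computable : Computables (λ v → evals (lookup v 0F) (tail v))
    mono       : ∀ {s t} xs {ys} → s ≤ t → evals s xs ≡ map suc ys → evals t xs ≡ map suc ys
    sound      : ∀ {s} xs ys → evals s xs ≡ map suc ys → Pointwise (λ c y → c [ xs ]⇓ y) cs ys
    complete   : ∀ {xs ys} → Pointwise (λ c y → c [ xs ]⇓ y) cs ys → ∃ λ s → evals s xs ≡ map suc ys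

stagedTotal : {c : Rec n} {f : Vec ℕ n → ℕ} → (∀ xs → c [ xs ]⇓ f xs) →
              (∀ {xs y} → c [ xs ]⇓ y → f xs ≡ y) → Staged c
stagedTotal {c = c} {f} c⇓ c⇓⁻¹ = record
  { eval       = λ _ xs → suc (f xs)
  ; computable = `suc (call (c , c⇓) rest₁)
  ; mono       = λ _ _ eq → eq
  ; sound      = λ xs eq → subst (c [ xs ]⇓_) (suc-injective eq) (c⇓ xs)
  ; complete   = λ d → 0 , cong suc (c⇓⁻¹ d)
  }

staged-[] : StagedVec {n} []
staged-[] = record
  { evals      = λ _ _ → []
  ; computable = ∅
  ; mono       = λ { _ {[]} _ _ → refl }
  ; sound      = λ { _ [] _ → [] }
  ; complete   = λ { [] → 0 , refl }
  }

staged-∷ : {c : Rec n} {cs : Vec (Rec n) m} → Staged c → StagedVec cs → StagedVec (c ∷ cs)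
staged-∷ C Cs = record
  { evals      = λ s xs → C.eval s xs ∷ Cs.evals s xs
  ; computable = C.computable ◂ Cs.computable
  ; mono       = λ { xs {_ ∷ _} s≤t eq → cong₂ _∷_ (C.mono xs s≤t (∷-injectiveˡ eq))
                                                    (Cs.mono xs s≤t (∷-injectiveʳ eq)) }
  ; sound      = λ { xs (_ ∷ ys) eq → C.sound xs (∷-injectiveˡ eq)
                                    ∷ Cs.sound xs ys (∷-injectiveʳ eq) }
  ; complete   = λ { (d ∷ ds) → let s , eq = C.complete d ; t , eqs = Cs.complete ds in
      s ⊔ t , cong₂ _∷_ (C.mono _ (m≤m⊔n s t) eq) (Cs.mono _ (m≤n⊔m s t) eqs) }
  }
  where
  module C  = Staged C
  module Cs = StagedVec Cs

staged-comp : {f : Rec m} {gs : Vec (Rec n) m} → Staged f → StagedVec gs → Staged (comp f gs)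
staged-comp {m} {n} {f} {gs} F G = record
  { eval       = eval
  ; computable = `bind (call (`allDefined m) G.computable)
                       (call F.computable (var 1F ◂ after rest₁ (after G.computable (mapPred m))))
  ; mono       = λ xs s≤t eq → let ys , gs≡ , f≡ = eval⁻ xs eq in
                   eval⁺ xs (G.mono xs s≤t gs≡) (F.mono ys s≤t f≡)
  ; sound      = λ xs eq → let ys , gs≡ , f≡ = eval⁻ xs eq in
                   comp⇓ (G.sound xs ys gs≡) (F.sound ys f≡)
  ; complete   = λ { {xs} (comp⇓ {ys = ys} ds d) →
      let s , eqs = G.complete ds ; t , eq = F.complete d in
      s ⊔ t , eval⁺ xs (G.mono xs (m≤m⊔n s t) eqs) (F.mono ys (m≤n⊔m s t) eq) }
  }
  where
  module F = Staged F
  module G = StagedVec G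
  eval : ℕ → Vec ℕ n → ℕ
  -- Without the guard, `pred` would turn an undefined inner result into the value 0.
  eval s xs = bind (allDefined (G.evals s xs)) λ _ → F.eval s (map pred (G.evals s xs))
  eval⁻ : ∀ {s} xs {z} → eval s xs ≡ suc z →
           ∃ λ ys → G.evals s xs ≡ map suc ys × F.eval s ys ≡ suc z
  eval⁻ {s} xs eq with bind-suc⁻¹ (allDefined (G.evals s xs)) eq
  ... | _ , def , eq′ = _ , allDefined-suc⁻¹ (G.evals s xs) def , eq′
  eval⁺ : ∀ {s} xs {ys z} → G.evals s xs ≡ map suc ys → F.eval s ys ≡ suc z → eval s xs ≡ suc z
  eval⁺ {s} xs {ys} gs≡ f≡
    rewrite gs≡ | allDefined-map-suc ys | map-pred-suc ys = f≡

staged-prec : {f : Rec n} {g : Rec (suc (suc n))} → Staged f → Staged g → Staged (prec f g)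
staged-prec {n} {f} {g} F G = record
  { eval       = λ { s (k ∷ xs) → eval s k xs }
  ; computable = Computable-resp-≗ (λ { (_ ∷ _ ∷ _) → refl })
                 (`rec (var 1F) (call F.computable (var 0F ◂ rest₂))
                       (`bind (var 1F) (call G.computable
                                         -- The context here is the previous value, the counter, its
                                         -- encoded result, the stage, the recursion argument, and
                                         -- then `xs`, which remains after dropping five entries.
                                         (var 3F ◂ var 1F ◂ var 0F ◂ after rest₂ (after rest₂ rest₁)))))
  ; mono       = λ { (k ∷ xs) → mono k xs }
  ; sound      = λ { (k ∷ xs) → sound k xs }
  ; complete   = λ { {k ∷ xs} → complete k xs }
  }
  where
  module F = Staged F
  module G = Staged G
  eval : ℕ → ℕ → Vec ℕ n → ℕ
  eval s k xs = recℕ (F.eval s xs) (λ k r → bind r λ w → G.eval s (k ∷ w ∷ xs)) k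
  mono : ∀ k {s t} xs {y} → s ≤ t → eval s k xs ≡ suc y → eval t k xs ≡ suc y
  mono zero    xs s≤t eq = F.mono xs s≤t eq
  mono (suc k) {s} xs s≤t eq with w , eq₁ , eq₂ ← bind-suc⁻¹ (eval s k xs) eq
    rewrite mono k xs s≤t eq₁ = G.mono _ s≤t eq₂
  sound : ∀ k {s} xs {y} → eval s k xs ≡ suc y → prec f g [ k ∷ xs ]⇓ y
  sound zero    xs eq = prec⇓-zero (F.sound xs eq)
  sound (suc k) {s} xs eq with w , eq₁ , eq₂ ← bind-suc⁻¹ (eval s k xs) eq =
    prec⇓-suc (sound k xs eq₁) (G.sound _ eq₂)
  complete : ∀ k xs {y} → prec f g [ k ∷ xs ]⇓ y → ∃ λ s → eval s k xs ≡ suc y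
  complete zero    xs (prec⇓-zero d) = F.complete d
  complete (suc k) xs (prec⇓-suc {y = w} d e)
    with s , eq₁ ← complete k xs d | t , eq₂ ← G.complete e =
    s ⊔ t , trans (cong (λ r → bind r λ w → G.eval (s ⊔ t) (k ∷ w ∷ xs))
                        (mono k xs (m≤m⊔n s t) eq₁))
                  (G.mono _ (m≤n⊔m s t) eq₂)

staged-min : {f : Rec (suc n)} → Staged f → Staged (min f)
staged-min {n} {f} F = record
  { eval       = eval
  ; computable = call (`bind body (`ifZero (var 0F) (`suc (var 1F)) `zero))
                      (`search (`pred body) (var 0F) ◂ all)
  ; mono       = λ xs s≤t eq → let y≤s , below , at = eval⁻ xs eq in
                   eval⁺ xs (≤-trans y≤s s≤t)
                         (λ j<y → let w , eq′ = below j<y in w , F.mono _ s≤t eq′)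
                         (F.mono _ s≤t at)
  ; sound      = λ xs eq → let y≤s , below , at = eval⁻ xs eq in
                   min⇓ (λ j<y → let w , eq′ = below j<y in w , F.sound _ eq′) (F.sound _ at)
  ; complete   = λ { {xs} {y} (min⇓ ds d) →
      -- The stage must also reach `y`, because it bounds the search for the least zero.
      let s , below = completes xs y ds ; t , at = F.complete d
          s≤ = m≤m⊔n s (t ⊔ y) ; ty≤ = m≤n⊔m s (t ⊔ y) in
      s ⊔ (t ⊔ y) , eval⁺ xs (≤-trans (m≤n⊔m t y) ty≤)
                          (λ j<y → let w , eq = below j<y in w , F.mono _ s≤ eq)
                          (F.mono _ (≤-trans (m≤m⊔n t y) ty≤) at) }
  }
  where
  module F = Staged F
  body : Computable {suc (suc n)} (λ v → F.eval (lookup v 1F) (lookup v 0F ∷ tail (tail v)))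
  body = call F.computable (var 1F ◂ var 0F ◂ rest₂)
  -- `pred` identifies "undefined so far" with "value 0", so the search stops at the first argument
  -- of either kind, and never skips an undefined one. Afterwards `eval` accepts the candidate only
  -- if its value is defined and 0.
  test : ℕ → Vec ℕ n → ℕ → ℕ
  test s xs k = pred (F.eval s (k ∷ xs))
  candidate : ℕ → Vec ℕ n → ℕ
  candidate s xs = search (test s xs) s
  eval : ℕ → Vec ℕ n → ℕ
  eval s xs = bind (F.eval s (candidate s xs ∷ xs)) λ v → ifZero v (suc (candidate s xs)) 0
  eval⁻ : ∀ {s} xs {y} → eval s xs ≡ suc y →
           y ≤ s × (∀ {j} → j < y → ∃ λ w → F.eval s (j ∷ xs) ≡ suc (suc w)) ×
           F.eval s (y ∷ xs) ≡ 1
  eval⁻ {s} xs eq with bind-suc⁻¹ (F.eval s (candidate s xs ∷ xs)) eq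
  ... | zero , at , refl =
    search≤ (test s xs) s , (λ j<y → pred≢0 _ (search-below (test s xs) s j<y)) , at
    where
    pred≢0 : ∀ k → pred k ≢ 0 → ∃ λ w → k ≡ suc (suc w)
    pred≢0 zero          k≢0 = contradiction refl k≢0
    pred≢0 (suc zero)    k≢0 = contradiction refl k≢0
    pred≢0 (suc (suc w)) _   = w , refl
  eval⁺ : ∀ {s} xs {y} → y ≤ s → (∀ {j} → j < y → ∃ λ w → F.eval s (j ∷ xs) ≡ suc (suc w)) →
          F.eval s (y ∷ xs) ≡ 1 → eval s xs ≡ suc y
  eval⁺ {s} xs {y} y≤s below at
    rewrite search-unique (test s xs) s y≤s
              (λ j<y eq → let w , eq′ = below j<y in
                 case trans (sym (cong pred eq′)) eq of λ ())
              (λ _ → cong pred at)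
          | at = refl
  -- Each argument below `y` has its own stage; induction on `y` collects these finitely many stages
  -- into one.
  completes : ∀ xs y → (∀ {j} → j < y → ∃ λ w → f [ j ∷ xs ]⇓ suc w) →
              ∃ λ s → ∀ {j} → j < y → ∃ λ w → F.eval s (j ∷ xs) ≡ suc (suc w)
  completes xs zero    ds = 0 , λ ()
  completes xs (suc y) ds
    with s , below ← completes xs y (λ j<y → ds (m<n⇒m<1+n j<y))
       | v , d ← ds (n<1+n y)
    with t , at ← F.complete d =
    s ⊔ t , λ j<1+y → case m<1+n⇒m<n∨m≡n j<1+y of λ where
      (inj₁ j<y)  → let w , eq = below j<y in w , F.mono _ (m≤m⊔n s t) eq
      (inj₂ refl) → v , F.mono _ (m≤n⊔m s t) at

staged    : (c : Rec n) → Staged c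
stagedVec : (cs : Vec (Rec n) m) → StagedVec cs

staged zer         = stagedTotal (λ _ → zer⇓) λ { zer⇓ → refl }
staged succ        = stagedTotal {f = suc ∘ head} (λ { (x ∷ []) → succ⇓ }) λ { succ⇓ → refl }
staged (proj i)    = stagedTotal (λ _ → proj⇓) λ { proj⇓ → refl }
staged (comp f gs) = staged-comp (staged f) (stagedVec gs)
staged (prec f g)  = staged-prec (staged f) (staged g)
staged (min f)     = staged-min (staged f)

stagedVec []       = staged-[]
stagedVec (c ∷ cs) = staged-∷ (staged c) (stagedVec cs)

-- Both outputs appear at a common later stage, where the approximation has only one value.
⇓-deterministic : (c : Rec n) → ∀ {xs y z} → c [ xs ]⇓ y → c [ xs ]⇓ z → y ≡ z
⇓-deterministic c {xs} d e with C.complete d | C.complete e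
  where module C = Staged (staged c)
... | s , eq₁ | t , eq₂ =
  suc-injective (trans (sym (C.mono xs (m≤m⊔n s t) eq₁)) (C.mono xs (m≤n⊔m s t) eq₂))
  where module C = Staged (staged c)

-- Passage between `ℛ¹`, `ℛ²` and the working notion of computability

ℛ¹⇒Computable₁ : ∀ {f} → ℛ¹ f → Computable₁ f
ℛ¹⇒Computable₁ (c , spec) = c , λ x → Equivalence.to (spec x _) refl

ℛ²⇒Computable₂ : ∀ {f} → ℛ² f → Computable₂ f
ℛ²⇒Computable₂ (c , spec) = c , λ x y → Equivalence.to (spec x y _) refl

Computable₁⇒ℛ¹ : ∀ {f} → Computable₁ f → ℛ¹ f
Computable₁⇒ℛ¹ (c , c⇓) = c , λ x y →
  mk⇔ (λ { refl → c⇓ x }) (⇓-deterministic c (c⇓ x))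

Computable₂⇒ℛ² : ∀ {f} → Computable₂ f → ℛ² f
Computable₂⇒ℛ² (c , c⇓) = c , λ x y z →
  mk⇔ (λ { refl → c⇓ x y }) (⇓-deterministic c (c⇓ x y))

-- Since n < f n and m ≤ g m, tracing n back along g ∘ f ends after at most n
-- steps, which makes the Cantor–Bernstein bijection of f and g computable: n goes
-- to r n if the origin of its chain lies in the range of g, and to f n otherwise.
module CantorBernstein
  (f : ℕ → ℕ) (f-injective : ∀ {x y} → f x ≡ f y → x ≡ y) (n<f : ∀ n → n < f n)
  (g r : ℕ → ℕ) (r∘g : ∀ m → r (g m) ≡ m) (m≤g : ∀ m → m ≤ g m) where

  -- A preimage of `n` under `g ∘ f` is smaller than `n`, so the bound `n` suffices; as the default
  -- value it makes every `n` without a preimage a fixed point.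
  back : ℕ → ℕ
  back n = search (λ x → ∣ g (f x) - n ∣) n

  iter : ℕ → ℕ → ℕ
  iter k n = recℕ n (λ _ → back) k

  origin : ℕ → ℕ
  origin n = iter n n

  -- zero iff the origin of n lies in the range of g
  side : ℕ → ℕ
  side n = ∣ g (r (origin n)) - origin n ∣

  to : ℕ → ℕ
  to n = ifZero (side n) (r n) (f n)

  -- The bound is justified by `x < f x`. Off the range of `f` the value is arbitrary, so `from`
  -- tests it.
  f⁻¹ : ℕ → ℕ
  f⁻¹ m = search (λ x → ∣ f x - m ∣) m

  -- A number `f x` was reached along `f` exactly when the chain of `x` does not start in the range
  -- of `g`. In all other cases `m` arose as `r (g m)`.
  from : ℕ → ℕ
  from m = ifZero ∣ f (f⁻¹ m) - m ∣ (ifZero (side (f⁻¹ m)) (g m) (f⁻¹ m)) (g m)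

  private
    g-injective : ∀ {x y} → g x ≡ g y → x ≡ y
    g-injective {x} {y} eq = trans (sym (r∘g x)) (trans (cong r eq) (r∘g y))

    back-gf : ∀ x → back (g (f x)) ≡ x
    back-gf x = search-only _ _ (<-≤-trans (n<f x) (m≤g (f x))) (∣n-n∣≡0 (g (f x)))
      λ eq → f-injective (g-injective (∣m-n∣≡0⇒m≡n eq))

    back-fixed : ∀ {n} → (∀ x → g (f x) ≢ n) → back n ≡ n
    back-fixed {n} gf≢n = search-unique _ n ≤-refl
      (λ {x} _ eq → gf≢n x (∣m-n∣≡0⇒m≡n eq)) (λ n<n → contradiction n<n (n≮n n))

    iter-back : ∀ k n → iter (suc k) n ≡ iter k (back n)
    iter-back zero    n = refl
    iter-back (suc k) n = cong back (iter-back k n)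

    iter-fixed : ∀ k {n} → back n ≡ n → iter k n ≡ n
    iter-fixed zero    eq = refl
    iter-fixed (suc k) eq = trans (cong back (iter-fixed k eq)) eq

    -- A step of `back` either strictly decreases its argument or leaves it fixed forever, so
    -- `k ≥ n` steps exhaust all decreases.
    iter-converges : ∀ k {n} → n ≤ k → back (iter k n) ≡ iter k n
    iter-converges zero    z≤n = refl
    iter-converges (suc k) {n} n≤1+k with m≤n⇒m<n∨m≡n (search≤ (λ x → ∣ g (f x) - n ∣) n)
    ... | inj₁ back<n = subst (λ i → back i ≡ i) (sym (iter-back k n))
                          (iter-converges k (s≤s⁻¹ (≤-trans back<n n≤1+k)))
    ... | inj₂ back≡n = subst (λ i → back i ≡ i) (sym (iter-fixed (suc k) back≡n)) back≡n

    iter-origin : ∀ k {n} → n ≤ k → iter k n ≡ origin n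
    iter-origin k n≤k with m≤n⇒m<n∨m≡n n≤k
    ... | inj₂ refl = refl
    iter-origin (suc k) n≤k | inj₁ n<1+k =
      trans (iter-converges k (s≤s⁻¹ n<1+k)) (iter-origin k (s≤s⁻¹ n<1+k))

    -- The first step back from `g (f x)` leads to `x`, and the steps that remain are at least `x`
    -- many, enough to reach the origin of `x`.
    origin-gf : ∀ x → origin (g (f x)) ≡ origin x
    origin-gf x with g (f x) | back-gf x | <-≤-trans (n<f x) (m≤g (f x))
    ... | suc k | back≡x | x<1+k =
      trans (iter-back k (suc k)) (trans (cong (iter k) back≡x) (iter-origin k (s≤s⁻¹ x<1+k)))

    side-gf : ∀ x → side (g (f x)) ≡ side x
    side-gf x = cong (λ o → ∣ g (r o) - o ∣) (origin-gf x)

    origin-fixed : ∀ {n} → (∀ x → g (f x) ≢ n) → origin n ≡ n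
    origin-fixed {n} gf≢n = iter-fixed n (back-fixed gf≢n)

    -- Either `n` has a preimage under `g ∘ f` and so lies in the range of `g`, or it is its own
    -- origin and `side` tests `n` itself.
    in-range-g : ∀ n → side n ≡ 0 → g (r n) ≡ n
    in-range-g n side≡0 with g (f (back n)) ≟ n
    ... | yes gfy≡n = trans (cong (g ∘ r) (sym gfy≡n)) (trans (cong g (r∘g _)) gfy≡n)
    ... | no  gfy≢n = subst (λ o → g (r o) ≡ o)
      (origin-fixed λ x gfx≡n →
        gfy≢n (trans (cong (g ∘ f) (trans (cong back (sym gfx≡n)) (back-gf x))) gfx≡n))
      (∣m-n∣≡0⇒m≡n side≡0)

    f⁻¹-f : ∀ x → f⁻¹ (f x) ≡ x
    f⁻¹-f x = search-only _ _ (n<f x) (∣n-n∣≡0 (f x)) (f-injective ∘ ∣m-n∣≡0⇒m≡n)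

    range-f? : ∀ m → range f m ⊎ (∀ x → f x ≢ m)
    range-f? m with f (f⁻¹ m) ≟ m
    ... | yes eq = inj₁ (f⁻¹ m , eq)
    ... | no neq = inj₂ λ x fx≡m →
      neq (trans (cong f (trans (cong f⁻¹ (sym fx≡m)) (f⁻¹-f x))) fx≡m)

    from-f : ∀ x → from (f x) ≡ ifZero (side x) (g (f x)) x
    from-f x rewrite f⁻¹-f x | ∣n-n∣≡0 (f x) = refl

    from-off : ∀ {m} → (∀ x → f x ≢ m) → from m ≡ g m
    from-off {m} f≢m with ∣ f (f⁻¹ m) - m ∣ in eq
    ... | zero  = contradiction (∣m-n∣≡0⇒m≡n eq) (f≢m (f⁻¹ m))
    ... | suc _ = refl

    to-g : ∀ m → side (g m) ≡ 0 → to (g m) ≡ m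
    to-g m side≡0 rewrite side≡0 = r∘g m

  -- If `m` is not in the range of `f`, then `g m` is its own origin and lies in the range of `g`,
  -- so `to` applies `r`. If `m` is `f x`, then `x` and `g (f x)` share a chain, and both maps
  -- decide by the same side.
  to∘from : ∀ m → to (from m) ≡ m
  to∘from m with range-f? m
  ... | inj₂ f≢m = trans (cong to (from-off f≢m)) (to-g m (m≡n⇒∣m-n∣≡0
          (subst (λ o → g (r o) ≡ o) (sym (origin-fixed (λ x → f≢m x ∘ g-injective)))
                 (cong g (r∘g m)))))
  ... | inj₁ (x , refl) with side x in eq | from-f x
  ...   | zero  | from≡ = trans (cong to from≡) (to-g (f x) (trans (side-gf x) eq))
  ...   | suc _ | from≡ = trans (cong to from≡) (cong (λ d → ifZero d (r x) (f x)) eq)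

  from∘to : ∀ n → from (to n) ≡ n
  from∘to n with side n in eq
  ... | suc _ = trans (from-f n) (cong (λ d → ifZero d (g (f n)) n) eq)
  ... | zero with range-f? (r n)
  ...   | inj₂ f≢rn = trans (from-off f≢rn) (in-range-g n eq)
  -- Here `n` is `g (f x)`, so `x` is on the same side as `n`, which makes `from` choose `g` over
  -- the preimage `x`.
  ...   | inj₁ (x , fx≡rn) = begin
    from (r n)                   ≡⟨ cong from fx≡rn ⟨
    from (f x)                   ≡⟨ from-f x ⟩
    ifZero (side x) (g (f x)) x  ≡⟨ cong (λ d → ifZero d (g (f x)) x) side≡0 ⟩
    g (f x)                      ≡⟨ gfx≡n ⟩
    n                            ∎
    where
    open ≡-Reasoning
    gfx≡n : g (f x) ≡ n
    gfx≡n = trans (cong g fx≡rn) (in-range-g n eq)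
    side≡0 : side x ≡ 0
    side≡0 = trans (sym (side-gf x)) (trans (cong side gfx≡n) eq)

  iso : ℕ ↔ ℕ
  iso = mk↔ₛ′ to from to∘from from∘to

  `to : Computable₁ f → Computable₁ g → Computable₁ r → Computable₁ to
  `to f′ g′ r′ = fn₁ (`ifZero `side (app₁ r′ (var 0F)) (app₁ f′ (var 0F)))
    where
    `back : Computable₁ back
    `back = fn₁ (`search `∣ app₁ g′ (app₁ f′ (var 0F)) - var 1F ∣ (var 0F))
    `origin : Computable {1} (λ xs → origin (lookup xs 0F))
    `origin = `rec (var 0F) (var 0F) (app₁ `back (var 1F))
    `side : Computable {1} (λ xs → side (lookup xs 0F))
    `side = `∣ app₁ g′ (app₁ r′ `origin) - `origin ∣

step<⇒mono : {f : ℕ → ℕ} → (∀ n → f n < f (suc n)) → ∀ {m n} → m < n → f m < f n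
step<⇒mono f< {m} {suc n} m<1+n with m<1+n⇒m<n∨m≡n m<1+n
... | inj₁ m<n  = <-trans (step<⇒mono f< m<n) (f< n)
... | inj₂ refl = f< m

step<⇒injective : {f : ℕ → ℕ} → (∀ n → f n < f (suc n)) → ∀ {m n} → f m ≡ f n → m ≡ n
step<⇒injective f< {m} {n} eq with <-cmp m n
... | tri< m<n _ _ = contradiction eq (<⇒≢ (step<⇒mono f< m<n))
... | tri≈ _ m≡n _ = m≡n
... | tri> _ _ n<m = contradiction (sym eq) (<⇒≢ (step<⇒mono f< n<m))

-- Numberings

≈-sym : {X Y : Set} {p q : X ⇀ Y} → p ≈ q → q ≈ p
≈-sym p≈q x y = ⇔.sym (p≈q x y)

≈-trans : {X Y : Set} {p q r : X ⇀ Y} → p ≈ q → q ≈ r → p ≈ r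
≈-trans p≈q q≈r x y = ⇔.trans (p≈q x y) (q≈r x y)

-- Computability of the projections of the pairing

module Projections (pairing : Pairing) where
  open Pairing pairing

  π₁ : ℕ → ℕ
  π₁ = proj₁ ∘ Inverse.from bijection

  ⟨π₁,π₂⟩ : ∀ z → ⟨ π₁ z , π₂ z ⟩ ≡ z
  ⟨π₁,π₂⟩ = Inverse.strictlyInverseˡ bijection

  π₁-⟨⟩ : ∀ x y → π₁ ⟨ x , y ⟩ ≡ x
  π₁-⟨⟩ x y = cong proj₁ (Inverse.strictlyInverseʳ bijection (x , y))

  π₂-⟨⟩ : ∀ x y → π₂ ⟨ x , y ⟩ ≡ y
  π₂-⟨⟩ x y = cong proj₂ (Inverse.strictlyInverseʳ bijection (x , y))

  ⟨⟩-injective : ∀ {x y x′ y′} → ⟨ x , y ⟩ ≡ ⟨ x′ , y′ ⟩ → x ≡ x′ × y ≡ y′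
  ⟨⟩-injective {x} {y} {x′} {y′} eq =
    trans (sym (π₁-⟨⟩ x y)) (trans (cong π₁ eq) (π₁-⟨⟩ x′ y′)) ,
    trans (sym (π₂-⟨⟩ x y)) (trans (cong π₂ eq) (π₂-⟨⟩ x′ y′))

  π₁≤ : ∀ z → π₁ z ≤ z
  π₁≤ z = subst (π₁ z ≤_) (⟨π₁,π₂⟩ z) (left≤ _ _)

  π₂≤ : ∀ z → π₂ z ≤ z
  π₂≤ z = subst (π₂ z ≤_) (⟨π₁,π₂⟩ z) (right≤ _ _)

  `⟨_,_⟩ : {f g : Vec ℕ n → ℕ} → Computable f → Computable g →
           Computable (λ xs → ⟨ f xs , g xs ⟩)
  `⟨_,_⟩ = app₂ (ℛ²⇒Computable₂ computable)

  private
    -- Only the pairing is given as computable; its inverse is found by bounded search, since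
    -- components do not exceed the pair. A wrong second component `y` merely yields the default
    -- `suc z`.
    fst : ℕ → ℕ → ℕ
    fst y z = search (λ x → ∣ ⟨ x , y ⟩ - z ∣) (suc z)

    fst-π₂ : ∀ z → fst (π₂ z) z ≡ π₁ z
    fst-π₂ z = search-only _ (suc z) (s≤s (π₁≤ z)) (m≡n⇒∣m-n∣≡0 (⟨π₁,π₂⟩ z))
      λ {x} eq → trans (sym (π₁-⟨⟩ x (π₂ z))) (cong π₁ (∣m-n∣≡0⇒m≡n eq))

    -- Whatever `fst y z` is for a wrong `y`, injectivity of the pairing prevents it from completing
    -- `y` to `z`.
    snd : ℕ → ℕ
    snd z = search (λ y → ∣ ⟨ fst y z , y ⟩ - z ∣) (suc z)

    snd≡π₂ : ∀ z → snd z ≡ π₂ z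
    snd≡π₂ z = search-only _ (suc z) (s≤s (π₂≤ z))
      (m≡n⇒∣m-n∣≡0 (trans (cong ⟨_, π₂ z ⟩ (fst-π₂ z)) (⟨π₁,π₂⟩ z)))
      λ {y} eq → trans (sym (π₂-⟨⟩ (fst y z) y)) (cong π₂ (∣m-n∣≡0⇒m≡n eq))

    `fst : {f g : Vec ℕ n → ℕ} → Computable f → Computable g → Computable (λ xs → fst (f xs) (g xs))
    `fst = app₂ {h = fst} (fn₂ (`search `∣ `⟨ var 0F , var 1F ⟩ - var 2F ∣ (`suc (var 1F))))

  `π₂ : {f : Vec ℕ n → ℕ} → Computable f → Computable (π₂ ∘ f)
  `π₂ {f = f} f′ = Computable-resp-≗ (λ xs → snd≡π₂ (f xs))
    (app₁ {h = snd} (fn₁ (`search `∣ `⟨ `fst (var 0F) (var 1F) , var 0F ⟩ - var 1F ∣ (`suc (var 0F)))) f′)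

  `π₁ : {f : Vec ℕ n → ℕ} → Computable f → Computable (π₁ ∘ f)
  `π₁ {f = f} f′ = Computable-resp-≗ (λ xs → fst-π₂ (f xs)) (`fst (`π₂ f′) f′)

-- Completeness of θ

module _ (pairing : Pairing) {A : Pred ℕ 0ℓ} {θ : ℕ → (ℕ ⇀ ℕ)} (qg : IsQuasiGödel pairing A θ) where
  open Pairing pairing
  open Projections pairing
  open IsQuasiGödel qg
  open IsNumbering isNumbering

  enum : ℕ → ℕ
  enum = proj₁ qgn₁

  `enum : {f : Vec ℕ n → ℕ} → Computable f → Computable (enum ∘ f)
  `enum = app₁ (ℛ¹⇒Computable₁ (proj₁ (proj₂ qgn₁)))

  enum-sound : ∀ u → ExtGraph² pairing (universal θ) (enum u)
  enum-sound u = proj₂ (proj₂ (proj₂ qgn₁)) (u , refl)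

  enum-complete : ∀ {z} → ExtGraph² pairing (universal θ) z → ∃ λ u → enum u ≡ z
  enum-complete = proj₁ (proj₂ (proj₂ qgn₁))

  realize : (k : ℕ → ℕ → ℕ) → Computable₂ k → ∃ λ v → Computable₁ v ×
            (∀ i r → r ∈ 𝒮 A → range (k i) ≐ ExtGraph¹ pairing r → θ (v i) ≈ r)
  realize k k′ = let v , v∈ℛ , spec = qgn₂ k (Computable₂⇒ℛ² k′) in
    v , ℛ¹⇒Computable₁ v∈ℛ , λ i r r∈𝒮 eq → ≈-sym {p = r} {θ (v i)} (spec i r r∈𝒮 eq)

  -- `G s i` approximates a partial function at `i` in encoded form. The parameter `s` is a stage of
  -- a program in `isComplete`, and a position in the enumeration `enum` in `diagonal`.
  module _ (G : ℕ → ℕ → ℕ) (G′ : Computable₂ G)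
           (consistent : ∀ {s t i j k} → G s i ≡ suc j → G t i ≡ suc k → j ≡ k) where
    private
      -- For `e` of the form `⟨ ⟨ j , x ⟩ , w ⟩`, the pair `⟨ x , w ⟩` is passed on once `G s i`
      -- shows the value `j`. Otherwise the output is `⟨ x , 0 ⟩`, which lies in every extended
      -- graph and reveals nothing.
      out : ℕ → ℕ → ℕ → ℕ
      out s i e = ⟨ π₂ (π₁ e) , ifZero ∣ G s i - suc (π₁ (π₁ e)) ∣ (π₂ e) 0 ⟩

      kernel : ℕ → ℕ → ℕ
      kernel i t = out (π₂ t) i (enum (π₁ t))

      `kernel : Computable₂ kernel
      `kernel = fn₂
        `⟨ `π₂ (`π₁ (`enum (`π₁ (var 1F))))
         , `ifZero `∣ app₂ G′ (`π₂ (var 1F)) (var 0F) - `suc (`π₁ (`π₁ (`enum (`π₁ (var 1F))))) ∣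
                   (`π₂ (`enum (`π₁ (var 1F)))) `zero ⟩

      out-⟨⟩ : ∀ s i j x w → out s i ⟨ ⟨ j , x ⟩ , w ⟩ ≡ ⟨ x , ifZero ∣ G s i - suc j ∣ w 0 ⟩
      out-⟨⟩ s i j x w
        rewrite π₁-⟨⟩ ⟨ j , x ⟩ w | π₂-⟨⟩ ⟨ j , x ⟩ w | π₁-⟨⟩ j x | π₂-⟨⟩ j x = refl

      kernel-⟨⟩ : ∀ i u s → kernel i ⟨ u , s ⟩ ≡ out s i (enum u)
      kernel-⟨⟩ i u s rewrite π₁-⟨⟩ u s | π₂-⟨⟩ u s = refl

      ifZero-0 : ∀ c → ifZero c 0 0 ≡ 0
      ifZero-0 zero    = refl
      ifZero-0 (suc _) = refl

      -- A general `r` covers both cases of completeness: `θ j` if the value `j` appears, `nowhere`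
      -- if no value does.
      range-kernel : ∀ i (r : ℕ ⇀ ℕ) →
        (∀ x y → graph r x y ⇔ ∃₂ λ s j → G s i ≡ suc j × graph (θ j) x y) →
        range (kernel i) ≐ ExtGraph¹ pairing r
      range-kernel i r r-spec =
        (λ { (t , refl) → kernel-sound (π₂ t) (enum-sound (π₁ t)) }) , kernel-complete
        where
        kernel-sound : ∀ s {e} → ExtGraph² pairing (universal θ) e → ExtGraph¹ pairing r (out s i e)
        kernel-sound s (inj₁ (j , x , refl)) =
          inj₁ (x , trans (out-⟨⟩ s i j x 0) (cong ⟨ x ,_⟩ (ifZero-0 ∣ G s i - suc j ∣)))
        kernel-sound s (inj₂ (j , x , y , θjx≡y , refl)) with ∣ G s i - suc j ∣ in eq | out-⟨⟩ s i j x (suc y)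
        ... | zero  | out≡ =
          inj₂ (x , y , Equivalence.from (r-spec x y) (s , j , ∣m-n∣≡0⇒m≡n eq , θjx≡y) , out≡)
        ... | suc _ | out≡ = inj₁ (x , out≡)
        kernel-complete : ∀ {z} → ExtGraph¹ pairing r z → range (kernel i) z
        -- Index 0 and stage 0 are arbitrary: the output is `⟨ x , 0 ⟩` whether or not the test
        -- succeeds.
        kernel-complete (inj₁ (x , refl)) with u , eq ← enum-complete (inj₁ (0 , x , refl)) =
          ⟨ u , 0 ⟩ , (begin
            kernel i ⟨ u , 0 ⟩                   ≡⟨ kernel-⟨⟩ i u 0 ⟩
            out 0 i (enum u)                     ≡⟨ cong (out 0 i) eq ⟩
            out 0 i ⟨ ⟨ 0 , x ⟩ , 0 ⟩            ≡⟨ out-⟨⟩ 0 i 0 x 0 ⟩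
            ⟨ x , ifZero ∣ G 0 i - 1 ∣ 0 0 ⟩     ≡⟨ cong ⟨ x ,_⟩ (ifZero-0 ∣ G 0 i - 1 ∣) ⟩
            ⟨ x , 0 ⟩                            ∎)
          where open ≡-Reasoning
        kernel-complete (inj₂ (x , y , rx≡y , refl))
          with s , j , Gsi≡ , θjx≡y ← Equivalence.to (r-spec x y) rx≡y
          with u , eq ← enum-complete (inj₂ (j , x , y , θjx≡y , refl)) =
          ⟨ u , s ⟩ , (begin
            kernel i ⟨ u , s ⟩                           ≡⟨ kernel-⟨⟩ i u s ⟩
            out s i (enum u)                             ≡⟨ cong (out s i) eq ⟩
            out s i ⟨ ⟨ j , x ⟩ , suc y ⟩                ≡⟨ out-⟨⟩ s i j x (suc y) ⟩
            ⟨ x , ifZero ∣ G s i - suc j ∣ (suc y) 0 ⟩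
              ≡⟨ cong (λ d → ⟨ x , ifZero d (suc y) 0 ⟩) (m≡n⇒∣m-n∣≡0 Gsi≡) ⟩
            ⟨ x , suc y ⟩                                ∎)
          where open ≡-Reasoning

    complete-staged : ∃ λ g → Computable₁ g × ∀ i →
      (∀ {s j} → G s i ≡ suc j → θ (g i) ≈ θ j) × ((∀ s → G s i ≡ 0) → θ (g i) ≈ nowhere)
    complete-staged = let g , g′ , g-spec = realize kernel `kernel in
      g , g′ , λ i →
      (λ {s} {j} Gsi≡ → g-spec i (θ j) (into j) (range-kernel i (θ j) λ x y →
        mk⇔ (λ θjx≡y → s , j , Gsi≡ , θjx≡y)
            (λ { (t , k , Gti≡ , θkx≡y) →
                 subst (λ k → graph (θ k) x y) (consistent Gti≡ Gsi≡) θkx≡y }))) ,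
      (λ Gi≡0 → g-spec i nowhere (inj₂ (inj₁ λ { _ (_ , ()) })) (range-kernel i nowhere λ x y →
        mk⇔ (λ ()) (λ { (t , k , Gti≡ , _) → case trans (sym (Gi≡0 t)) Gti≡ of λ () })))

  isComplete : IsComplete θ nowhere
  isComplete p (c , c-spec) =
    let g , g′ , g-spec = complete-staged (λ s i → C.eval s (i ∷ [])) (fn₂ C.computable)
                            (λ eq₁ eq₂ → ⇓-deterministic c (C.sound _ eq₁) (C.sound _ eq₂))
    in g , Computable₁⇒ℛ¹ g′ , λ i →
      (λ j pij → proj₁ (g-spec i) (proj₂ (C.complete (Equivalence.to (c-spec i j) pij)))) ,
      (λ i∉dom → proj₂ (g-spec i) λ s → undefined i i∉dom s)
    where
    module C = Staged (staged c)
    undefined : ∀ i → ¬ dom p i → ∀ s → C.eval s (i ∷ []) ≡ 0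
    undefined i i∉dom s with C.eval s (i ∷ []) in eq
    ... | zero  = refl
    ... | suc j = contradiction (j , Equivalence.from (c-spec i j) (C.sound _ eq)) i∉dom

  -- The recursion theorem and padding for θ

  diagonal : ∃ λ h → Computable₁ h × ∀ z {y} → graph (θ (π₂ z)) z y → θ (h z) ≈ θ y
  diagonal = let h , h′ , h-spec = complete-staged D `D consistent in
    h , h′ , λ z eq → proj₁ (h-spec z) (proj₂ (D-complete eq))
    where
    -- The second component of an element of an extended graph, 0 or the successor of a value, is
    -- already an encoded partial value. So `enum` supplies the approximations directly.
    D : ℕ → ℕ → ℕ
    D u z = ifZero ∣ π₁ (enum u) - ⟨ π₂ z , z ⟩ ∣ (π₂ (enum u)) 0
    `D : Computable₂ D
    `D = fn₂ (`ifZero `∣ `π₁ (`enum (var 0F)) - `⟨ `π₂ (var 1F) , var 1F ⟩ ∣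
                      (`π₂ (`enum (var 0F))) `zero)
    D-complete : ∀ {z y} → graph (θ (π₂ z)) z y → ∃ λ u → D u z ≡ suc y
    D-complete {z} {y} θzz≡y with u , eq ← enum-complete (inj₂ (π₂ z , z , y , θzz≡y , refl))
      = u , (begin
        D u z                                     ≡⟨ cong (λ e → ifZero ∣ π₁ e - a ∣ (π₂ e) 0) eq ⟩
        ifZero ∣ π₁ ⟨ a , suc y ⟩ - a ∣ (π₂ ⟨ a , suc y ⟩) 0
          ≡⟨ cong₂ (λ d w → ifZero d w 0) (m≡n⇒∣m-n∣≡0 (π₁-⟨⟩ a (suc y))) (π₂-⟨⟩ a (suc y)) ⟩
        suc y                                     ∎)
      where
      open ≡-Reasoning
      a = ⟨ π₂ z , z ⟩
    D-sound : ∀ {u z y} → D u z ≡ suc y → graph (θ (π₂ z)) z y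
    D-sound {u} {z} {y} eq with ∣ π₁ (enum u) - ⟨ π₂ z , z ⟩ ∣ in d≡0
    ... | zero with enum-sound u
    ...   | inj₁ (_ , _ , e≡) =
      contradiction (trans (sym eq) (trans (cong π₂ e≡) (π₂-⟨⟩ _ 0))) λ ()
    ...   | inj₂ (j , x , w , θjx≡w , e≡) = transport (⟨⟩-injective jx≡) w≡ θjx≡w
      where
      jx≡ : ⟨ j , x ⟩ ≡ ⟨ π₂ z , z ⟩
      jx≡ = trans (sym (trans (cong π₁ e≡) (π₁-⟨⟩ _ (suc w)))) (∣m-n∣≡0⇒m≡n d≡0)
      w≡ : suc w ≡ suc y
      w≡ = trans (sym (trans (cong π₂ e≡) (π₂-⟨⟩ _ (suc w)))) eq
      transport : ∀ {j j′ x x′ w w′} → j ≡ j′ × x ≡ x′ → suc w ≡ suc w′ →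
                  graph (θ j) x w → graph (θ j′) x′ w′
      transport (refl , refl) refl θjx≡w = θjx≡w
    consistent : ∀ {s t z j k} → D s z ≡ suc j → D t z ≡ suc k → j ≡ k
    consistent {z = z} eq₁ eq₂ = functional (θ (π₂ z)) (D-sound eq₁) (D-sound eq₂)

  -- With `e` an index of the total function `z ↦ f (π₁ z) (h z)`, the argument `z = ⟨ x , e ⟩`
  -- makes the diagonal evaluate `θ e` at `z`, so that `h z` is the fixed point for `x`.
  recursion : (f : ℕ → ℕ → ℕ) → Computable₂ f →
              ∃ λ n → Computable₁ n × ∀ x → θ (n x) ≈ θ (f x (n x))
  recursion f f′ =
    let h , h′ , h-spec = diagonal
        e , θe≈ = onto (total λ z → f (π₁ z) (h z))
                    (inj₁ (_ , Computable₁⇒ℛ¹ (fn₁ (app₂ f′ (`π₁ (var 0F)) (app₁ h′ (var 0F))))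
                             , λ _ _ → ⇔.refl))
    in (λ x → h ⟨ x , e ⟩) ,
      fn₁ (app₁ h′ `⟨ var 0F , `const e ⟩) ,
      λ x → h-spec ⟨ x , e ⟩ (subst (λ i → graph (θ i) ⟨ x , e ⟩ (f x (h ⟨ x , e ⟩)))
        (sym (π₂-⟨⟩ x e))
        (Equivalence.from (θe≈ _ _) (cong (λ y → f y (h ⟨ x , e ⟩)) (π₁-⟨⟩ x e))))

  -- An infinite supply of pairwise different functions with computable indices, used to spoil small
  -- fixed points. In the kernel, `t = ⟨ x , 0 ⟩` lists `⟨ x , 0 ⟩`, and every other `t` with first
  -- component `x` lists the value `k` at `x`.
  constants : ∃ λ a → Computable₁ a × ∀ k → θ (a k) ≈ total (const k)
  constants = let a , a′ , a-spec = realize kernel `kernel in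
    a , a′ , λ k → a-spec k (total (const k))
      (inj₁ (const k , Computable₁⇒ℛ¹ (fn₁ (`const k)) , λ _ _ → ⇔.refl)) (sound k , complete k)
    where
    kernel : ℕ → ℕ → ℕ
    kernel k t = ⟨ π₁ t , ifZero (π₂ t) 0 (suc k) ⟩
    `kernel : Computable₂ kernel
    `kernel = fn₂ `⟨ `π₁ (var 1F) , `ifZero (`π₂ (var 1F)) `zero (`suc (var 0F)) ⟩
    kernel-⟨⟩ : ∀ k x w → kernel k ⟨ x , w ⟩ ≡ ⟨ x , ifZero w 0 (suc k) ⟩
    kernel-⟨⟩ k x w = cong₂ (λ x w → ⟨ x , ifZero w 0 (suc k) ⟩) (π₁-⟨⟩ x w) (π₂-⟨⟩ x w)
    sound : ∀ k {z} → range (kernel k) z → ExtGraph¹ pairing (total (const k)) z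
    sound k (t , refl) with π₂ t
    ... | zero  = inj₁ (π₁ t , refl)
    ... | suc _ = inj₂ (π₁ t , k , refl , refl)
    complete : ∀ k {z} → ExtGraph¹ pairing (total (const k)) z → range (kernel k) z
    complete k (inj₁ (x , refl))            = ⟨ x , 0 ⟩ , kernel-⟨⟩ k x 0
    complete k (inj₂ (x , _ , refl , refl)) = ⟨ x , 1 ⟩ , kernel-⟨⟩ k x 1

  private
    -- The parameters are packed as `w = ⟨ i , ⟨ N , k ⟩ ⟩` for `recursion`; the truncated
    -- difference vanishes exactly when the proposed index `y` is at most `N`.
    target : (ℕ → ℕ) → ℕ → ℕ → ℕ
    target a w y = ifZero (y ∸ π₁ (π₂ w)) (a (π₂ (π₂ w))) (π₁ w)

    `target : ∀ {a} → Computable₁ a → Computable₂ (target a)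
    `target a′ = fn₂ (`ifZero (var 1F `∸ `π₁ (`π₂ (var 0F)))
                              (app₁ a′ (`π₂ (`π₂ (var 0F)))) (`π₁ (var 0F)))

  -- The fixed point n_k of target satisfies θ(n_k) = const k if n_k ≤ N, and θ(n_k) = θᵢ
  -- otherwise.  The n_k that are ≤ N are pairwise distinct, so that n_k > N for some
  -- k ≤ N + 1.
  module Padding (a : ℕ → ℕ) (a-spec : ∀ k → θ (a k) ≈ total (const k))
                 (n : ℕ → ℕ) (n′ : Computable₁ n) (n-spec : ∀ w → θ (n w) ≈ θ (target a w (n w))) where
    fix : ℕ → ℕ → ℕ → ℕ
    fix i N k = n ⟨ i , ⟨ N , k ⟩ ⟩
    fix-spec : ∀ i N k → θ (fix i N k) ≈ θ (ifZero (fix i N k ∸ N) (a k) i)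
    fix-spec i N k = subst (λ j → θ (fix i N k) ≈ θ j) (unpair (fix i N k)) (n-spec ⟨ i , ⟨ N , k ⟩ ⟩)
      where
      unpair : ∀ y → target a ⟨ i , ⟨ N , k ⟩ ⟩ y ≡ ifZero (y ∸ N) (a k) i
      unpair y rewrite π₁-⟨⟩ i ⟨ N , k ⟩ | π₂-⟨⟩ i ⟨ N , k ⟩ | π₁-⟨⟩ N k | π₂-⟨⟩ N k = refl
    deficit : ℕ → ℕ → ℕ → ℕ
    deficit i N k = suc N ∸ fix i N k
    -- The deficit is 0 exactly when the fixed point exceeds `N`. The default `suc N` is itself a
    -- valid choice: if all smaller `k` fail, it must succeed by `not-all-near`.
    index : ℕ → ℕ → ℕ
    index i N = search (deficit i N) (suc N)
    pad : ℕ → ℕ → ℕ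
    pad i N = fix i N (index i N)
    `fix : ∀ {m} {f g h : Vec ℕ m → ℕ} → Computable f → Computable g → Computable h →
           Computable (λ xs → fix (f xs) (g xs) (h xs))
    `fix f g h = app₁ n′ `⟨ f , `⟨ g , h ⟩ ⟩
    `pad : Computable₂ pad
    `pad = fn₂ (`fix (var 0F) (var 1F)
      (`search (`suc (var 2F) `∸ `fix (var 1F) (var 2F) (var 0F)) (`suc (var 1F))))
    near : ∀ i N k → fix i N k ≤ N → θ (fix i N k) ≈ total (const k)
    near i N k y≤N = ≈-trans {p = θ (fix i N k)} {θ (a k)} {total (const k)}
      (subst (λ d → θ (fix i N k) ≈ θ (ifZero d (a k) i)) (m≤n⇒m∸n≡0 y≤N) (fix-spec i N k)) (a-spec k)
    -- There are `N + 2` choices of `k` but only `N + 1` indices up to `N`, so some index would name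
    -- two different constant functions.
    not-all-near : ∀ i N → ¬ (∀ k → k ≤ suc N → fix i N k ≤ N)
    not-all-near i N all≤ with j , k , j<k , eq ← pigeonhole (n<1+n (suc N))
                                 (λ k → fromℕ< (s≤s (all≤ (toℕ k) (s≤s⁻¹ (toℕ<n k))))) =
      <⇒≢ j<k (Equivalence.to (const≈const 0 (toℕ k)) refl)
      where
      fix≡ : fix i N (toℕ k) ≡ fix i N (toℕ j)
      fix≡ = sym (fromℕ<-injective _ _ _ _ eq)
      const≈const : total (const (toℕ k)) ≈ total (const (toℕ j))
      const≈const = ≈-trans {p = total (const (toℕ k))} {θ (fix i N (toℕ k))} {total (const (toℕ j))}
        (≈-sym {p = θ (fix i N (toℕ k))} {total (const (toℕ k))}
               (near i N (toℕ k) (all≤ (toℕ k) (s≤s⁻¹ (toℕ<n k)))))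
        (subst (λ y → θ y ≈ total (const (toℕ j))) (sym fix≡)
               (near i N (toℕ j) (all≤ (toℕ j) (s≤s⁻¹ (toℕ<n j)))))
    N<pad : ∀ i N → N < pad i N
    N<pad i N with m≤n⇒m<n∨m≡n (search≤ (deficit i N) (suc N))
    ... | inj₁ index<1+N = m∸n≡0⇒m≤n (search-zero (deficit i N) (suc N) index<1+N)
    ... | inj₂ index≡1+N = ≰⇒> λ pad≤N → not-all-near i N λ k k≤1+N →
      case m≤n⇒m<n∨m≡n (≤-trans k≤1+N (≤-reflexive (sym index≡1+N))) of λ where
        (inj₁ k<index) → s≤s⁻¹ (m∸n≢0⇒n<m (search-below (deficit i N) (suc N) k<index))
        (inj₂ refl)    → pad≤N
    far : ∀ i N → θ (ifZero (pad i N ∸ N) (a (index i N)) i) ≈ θ i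
    far i N with pad i N ∸ N in eq
    ... | zero = contradiction (m∸n≡0⇒m≤n eq) (<⇒≱ (N<pad i N))
    ... | suc _ = λ _ _ → ⇔.refl
    pad-correct : ∀ i N → θ (pad i N) ≈ θ i
    pad-correct i N = ≈-trans {p = θ (pad i N)} {θ (ifZero (pad i N ∸ N) (a (index i N)) i)} {θ i}
      (fix-spec i N (index i N)) (far i N)

  padding : ∃ λ pad → Computable₂ pad × ∀ i N → N < pad i N × θ (pad i N) ≈ θ i
  padding =
    let a , a′ , a-spec = constants
        n , n′ , n-spec = recursion (target a) (`target a′)
        open Padding a a-spec n n′ n-spec
    in pad , `pad , λ i N → N<pad i N , pad-correct i N

  -- Cylindricity of θ

  module Cylinder (pad : ℕ → ℕ → ℕ) (`pad : Computable₂ pad)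
                  (pad-spec : ∀ i N → N < pad i N × θ (pad i N) ≈ θ i) where
    private
      -- Padding each index beyond the previous value makes the sequence strictly increasing. The
      -- initial 0 only serves as the first bound and is skipped by `f`, which is why `n < f n`
      -- holds from `n = 0` on.
      pads : ℕ → ℕ
      pads = recℕ 0 λ n → pad (π₂ n)

      f : ℕ → ℕ
      f n = pads (suc n)

      pads< : ∀ n → pads n < f n
      pads< n = proj₁ (pad-spec (π₂ n) (pads n))

      n<f : ∀ n → n < f n
      n<f zero    = pads< 0
      n<f (suc n) = ≤-<-trans (n<f n) (pads< (suc n))

    -- The left inverse `π₂` of `m ↦ ⟨ 0 , m ⟩` sends every `n` to an index of `θᶜ` at `n`, even off
    -- the range, so both branches of `to` respect the numberings.
    open CantorBernstein f (step<⇒injective (λ n → pads< (suc n))) n<f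
                         (λ m → ⟨ 0 , m ⟩) π₂ (π₂-⟨⟩ 0) (right≤ 0)

    isCylindrical : IsCylindrical pairing θ
    isCylindrical = iso ,
      Computable₁⇒ℛ¹ (`to (fn₁ (`rec (`suc (var 0F)) `zero (app₂ `pad (`π₂ (var 0F)) (var 1F))))
                          (fn₁ `⟨ `zero , var 0F ⟩) (fn₁ (`π₂ (var 0F)))) ,
      cylinder≈
      where
      cylinder≈ : ∀ n → θ (π₂ n) ≈ θ (to n)
      cylinder≈ n with side n
      ... | zero  = λ _ _ → ⇔.refl
      ... | suc _ = ≈-sym {p = θ (f n)} {θ (π₂ n)} (proj₂ (pad-spec (π₂ n) (pads n)))

theorem8p3 : (pairing : Pairing) (A : Pred ℕ 0ℓ) → Inf A → ComputablyEnumerable A →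
    (θ : ℕ → (ℕ ⇀ ℕ)) → IsQuasiGödel pairing A θ →
    IsComplete θ nowhere × IsCylindrical pairing θ
theorem8p3 pairing A _ _ θ qg =
  let pad , `pad , pad-spec = padding pairing qg in
  isComplete pairing qg , Cylinder.isCylindrical pairing qg pad `pad pad-spec
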